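{- Let $q$ be a prime power, let $n,t,s$ be positive integers with $\gcd(s,n)=1$, and let $\sigma\colon x\mapsto x^{q^s}$, an automorphism of $\mathbb{F}_{q^{nt}}$ (whose restriction generates $\mathrm{Gal}(\mathbb{F}_{q^n}\colon\mathbb{F}_q)$). Let $b_0,\dots,b_{t-1}\in\mathbb{F}_{q^{nt}}$ and \[ f(x)=-x+b_0x^{\sigma}+b_1x^{\sigma q^n}+b_2x^{\sigma q^{2n}}+\cdots+b_{t-1}x^{\sigma q^{n(t-1)}}. \] Let $G(x)=\sum_{i=0}^{t-1}b_ix^{q^{ni}}$, $H=G\circ\sigma$ and $L=H^{n-1}+H^{n-2}+\cdots+H+\mathrm{id}$. Then \[ \ker f=L(E_1(H^n)), \] where $E_1(H^n)=\{y\in\mathbb{F}_{q^{nt}}\colon H^n(y)=y\}$.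
   Context: Notation: $x^{\sigma q^{ni}}:=x^{q^{s+ni}}$. Polynomials are identified with the maps $\mathbb{F}_{q^{nt}}\to\mathbb{F}_{q^{nt}}$ they induce; $\ker f$ is the set of roots of $f$ in $\mathbb{F}_{q^{nt}}$. $H^i$ denotes the $i$-fold composition of $H$ with itself, and $\mathrm{id}$ the identity map. -}

module Defs where

open import Algebra.Apartness.Bundles using (HeytingField; HeytingCommutativeRing)
import Algebra.Properties.Monoid.Sum as Sum
import Algebra.Properties.Semiring.Exp as Exp
open import Algebra.Bundles using (CommutativeRing)
open import Data.Fin.Base using (Fin; toℕ)
open import Data.Nat.Base as ℕ using (ℕ; NonZero)
open import Data.Nat.Primality using (Prime)
open import Data.Product.Base using (_×_; ∃-syntax)
open import Function.Base using (_∘_)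
open import Function.Bundles using (Inverse)
import Function.Endo.Propositional as Endo
open import Level using (Level; _⊔_)
open import Relation.Binary.PropositionalEquality using (_≡_; setoid)
open import Relation.Unary using (Pred)

private
  variable
    c ℓ₁ ℓ₂ : Level

IsPrimePower : ℕ → Set
IsPrimePower q = ∃[ p ] ∃[ k ] (Prime p × NonZero k × q ≡ p ℕ.^ k)

commutativeRing : HeytingField c ℓ₁ ℓ₂ → CommutativeRing c ℓ₁
commutativeRing F =
  HeytingCommutativeRing.commutativeRing (HeytingField.heytingCommutativeRing F)

-- A Heyting field of order N has decidable equality, so its apartness is
-- just the negation of equality and it is a finite field in the usual sense;
-- conversely every finite field becomes a Heyting field in this way.
HasOrder : HeytingField c ℓ₁ ℓ₂ → ℕ → Set (c ⊔ ℓ₁)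
HasOrder F N = Inverse (CommutativeRing.setoid (commutativeRing F)) (setoid (Fin N))

module Maps {c ℓ₁ ℓ₂ : Level} (F : HeytingField c ℓ₁ ℓ₂) where

  open CommutativeRing (commutativeRing F) public
  open Sum +-monoid public using (sum)
  open Exp semiring public using (_^_)
  open Endo Carrier public using (Endo) renaming (_^_ to _^∘_)

  ker : Endo → Pred Carrier ℓ₁
  ker φ x = φ x ≈ 0#

  E₁ : Endo → Pred Carrier ℓ₁
  E₁ φ y = φ y ≈ y

  image : {ℓ : Level} → Endo → Pred Carrier ℓ → Pred Carrier (c ⊔ ℓ₁ ⊔ ℓ)
  image φ P x = ∃[ y ] (P y × φ y ≈ x)

  module Polynomials (q n t s : ℕ) (b : Fin t → Carrier) where

    σ : Endo
    σ x = x ^ (q ℕ.^ s)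

    -- x^{σ q^{ni}} is notation for x^{q^{s+ni}}.
    f : Endo
    f x = - x + sum λ (i : Fin t) → b i * x ^ (q ℕ.^ (s ℕ.+ n ℕ.* toℕ i))

    G : Endo
    G x = sum λ (i : Fin t) → b i * x ^ (q ℕ.^ (n ℕ.* toℕ i))

    H : Endo
    H = G ∘ σ

    L : Endo
    L x = sum λ (i : Fin n) → (H ^∘ toℕ i) x

{-# OPTIONS --safe #-}

-- Since x^{σ q^{ni}} = (x^σ)^{q^{ni}}, f = H - id, so ker f is the set of fixed
-- points of the additive map H. If H^n(y) = y, then H(L(y)) - L(y) telescopes to
-- H^n(y) - y = 0. Conversely H(m x) = m^σ H(x) when m lies in F_{q^n}; so if
-- H(x) = x, then H^n(m x) = m x and L(m x) = (Σ_{i<n} m^{q^{si}}) x, and the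
-- coefficient is the trace of m over F_q because gcd(s, n) = 1. For an m of trace 1,
-- pick z with c = Σ_{k<nt} z^{q^k} ≠ 0 (a polynomial of degree q^{nt-1} does not
-- vanish on the whole field) and take m = c⁻¹ Σ_{j<t} z^{q^{nj}}.
module Submission where

open import Defs
open import Algebra.Apartness.Bundles using (HeytingField)
open import Algebra.Bundles using (CommutativeMonoid; CommutativeRing; CommutativeSemiring)
import Algebra.Properties.CommutativeMonoid.Sum as CMSum
import Algebra.Properties.CommutativeSemiring.Binomial as Binomial
import Algebra.Properties.CommutativeSemiring.Exp as Exp
import Algebra.Properties.Group as Group
import Algebra.Properties.Ring as Ring
import Algebra.Properties.Semiring.Mult as Mult
import Algebra.Properties.Semiring.Sum as SemiringSum
import Algebra.Solver.Ring.NaturalCoefficients.Default as Solver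
open import Data.Bool.Base using (if_then_else_)
open import Data.Fin.Base as Fin using (Fin; toℕ; fromℕ<; zero; suc)
open import Data.Fin.Permutation using (Permutation′; permutation; _⟨$⟩ʳ_)
import Data.Fin.Properties as Fin
open import Data.Nat.Base as ℕ using (ℕ; zero; suc; NonZero; s≤s; z≤n; _∸_; ∣_-_∣; _!)
open import Data.Nat.Combinatorics using (_C_; nCn≡1; nCk≡n!/k![n-k]!; k![n∸k]!∣n!)
open import Data.Nat.Coprimality as Coprime using (gcd≡1⇒coprime; coprime-divisor)
open import Data.Nat.Divisibility using (_∣_; _∤_; divides; >⇒∤; m∣m*n; ∣1⇒≡1)
open import Data.Nat.DivMod using (_/_; _%_; m%n<n; m≡m%n+[m/n]*n; m/n*n≡m)
open import Data.Nat.GCD using (gcd)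
open import Data.Nat.Primality using (Prime; euclidsLemma; prime⇒nonTrivial; prime⇒nonZero)
import Data.Nat.Properties as ℕ
open import Data.Product.Base using (∃-syntax; _×_; _,_; proj₁; proj₂)
open import Data.Sum.Base using (inj₁; inj₂)
open import Data.Vec.Base using (Vec; []; _∷_)
open import Data.Vec.Functional using (removeAt)
open import Function.Base using (_∘_)
open import Function.Bundles using (Inverse)
open import Function.Definitions using (Injective)
open import Level using (Level)
open import Relation.Binary.Core using (_Preserves_⟶_)
open import Relation.Binary.PropositionalEquality as ≡ using (_≡_; _≢_; cong; cong₂)
open import Relation.Nullary.Decidable using (Dec; yes; no; does; map′; dec-true; dec-false)
open import Relation.Nullary.Negation using (¬_; contradiction)
open import Relation.Unary using (_≐_)

-- Injective self-maps of finite sets, and multiplication by s modulo n.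

injective⇒surjective : ∀ {n} {f : Fin n → Fin n} → Injective _≡_ _≡_ f → ∀ y → ∃[ x ] f x ≡ y
injective⇒surjective {suc n} {f} inj y with Fin.any? (λ x → f x Fin.≟ y)
... | yes hit = hit
-- If `y` were missed, punching it out would give an injection of `Fin (suc n)` into `Fin n`.
... | no miss = contradiction
  (Fin.injective⇒≤ λ {i} {j} eq → inj (Fin.punchOut-injective (avoids i) (avoids j) eq)) ℕ.1+n≰n
  where
  avoids : ∀ x → ¬ y ≡ f x
  avoids x eq = miss (x , ≡.sym eq)

injective⇒permutation : ∀ {n} (f : Fin n → Fin n) → Injective _≡_ _≡_ f → Permutation′ n
injective⇒permutation f inj =
  permutation f (proj₁ ∘ surj) (proj₂ ∘ surj) λ x → inj (proj₂ (surj (f x)))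
  where surj = injective⇒surjective inj

%-≡⇒∣∣-∣ : ∀ a b n .{{_ : NonZero n}} → a % n ≡ b % n → n ∣ ∣ a - b ∣
%-≡⇒∣∣-∣ a b n eq = divides ∣ a / n - b / n ∣ (begin
  ∣ a - b ∣
    ≡⟨ cong₂ ∣_-_∣ (m≡m%n+[m/n]*n a n) (m≡m%n+[m/n]*n b n) ⟩
  ∣ a % n ℕ.+ a / n ℕ.* n - b % n ℕ.+ b / n ℕ.* n ∣
    ≡⟨ cong (λ r → ∣ a % n ℕ.+ a / n ℕ.* n - r ℕ.+ b / n ℕ.* n ∣) eq ⟨
  ∣ a % n ℕ.+ a / n ℕ.* n - a % n ℕ.+ b / n ℕ.* n ∣  ≡⟨ ℕ.∣m+n-m+o∣≡∣n-o∣ (a % n) _ _ ⟩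
  ∣ a / n ℕ.* n - b / n ℕ.* n ∣                      ≡⟨ ℕ.*-distribʳ-∣-∣ n (a / n) (b / n) ⟨
  ∣ a / n - b / n ∣ ℕ.* n                            ∎)
  where open ≡.≡-Reasoning

module _ (s n : ℕ) .{{_ : NonZero n}} where

  scale : Fin n → Fin n
  scale i = fromℕ< (m%n<n (s ℕ.* toℕ i) n)

  -- If s i and s j agree modulo n, then n divides s |i - j|, hence |i - j| by coprimality. As |i -
  -- j| < n, it must be zero.
  scale-injective : gcd s n ≡ 1 → Injective _≡_ _≡_ scale
  scale-injective s⊥n {i} {j} eq with ∣ toℕ i - toℕ j ∣ in d
  ... | zero = Fin.toℕ-injective (ℕ.∣m-n∣≡0⇒m≡n d)
  ... | suc _ = contradiction n∣i-j (>⇒∤ i-j<n)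
    where
    n∣i-j = ≡.subst (n ∣_) d
      (coprime-divisor (Coprime.sym (gcd≡1⇒coprime {s} s⊥n))
        (≡.subst (n ∣_) (≡.sym (ℕ.*-distribˡ-∣-∣ s (toℕ i) (toℕ j)))
          (%-≡⇒∣∣-∣ (s ℕ.* toℕ i) (s ℕ.* toℕ j) n (Fin.fromℕ<-injective _ _ _ _ eq))))
    i-j<n = ≡.subst (ℕ._< n) d
      (ℕ.≤-<-trans (ℕ.∣m-n∣≤m⊔n (toℕ i) (toℕ j)) (ℕ.⊔-lub (Fin.toℕ<n i) (Fin.toℕ<n j)))

-- Binomial coefficients divisible by a prime.

prime∤! : ∀ {p} → Prime p → ∀ k → k ℕ.< p → p ∤ k !
prime∤! p-prime zero _ p∣1 with ∣1⇒≡1 p∣1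
... | ≡.refl = contradiction (prime⇒nonTrivial p-prime) λ()
prime∤! p-prime (suc k) 1+k<p p∣ with euclidsLemma (suc k) (k !) p-prime p∣
... | inj₁ p∣1+k = >⇒∤ 1+k<p p∣1+k
... | inj₂ p∣k!  = prime∤! p-prime k (ℕ.<⇒≤ 1+k<p) p∣k!

-- The prime divides p! = (p C k) k! (p - k)!, but neither factorial on the right, since both k and
-- p - k are smaller than p.
prime∣C : ∀ {p k} → Prime p → 0 ℕ.< k → k ℕ.< p → p ∣ p C k
prime∣C {suc p-1} {k} p-prime 0<k k<p with euclidsLemma (p C k) (k ! ℕ.* (p ℕ.∸ k) !) p-prime p∣C*k!*[p∸k]!
  where
  p = suc p-1
  instance _ = k ℕ.!* (p ℕ.∸ k) !≢0
  p∣C*k!*[p∸k]! : p ∣ (p C k) ℕ.* (k ! ℕ.* (p ℕ.∸ k) !)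
  p∣C*k!*[p∸k]! = ≡.subst (p ∣_)
    (≡.sym (≡.trans (cong (ℕ._* (k ! ℕ.* (p ℕ.∸ k) !)) (nCk≡n!/k![n-k]! (ℕ.<⇒≤ k<p)))
      (m/n*n≡m (k![n∸k]!∣n! (ℕ.<⇒≤ k<p)))))
    (m∣m*n (p-1 !))
... | inj₁ p∣C = p∣C
... | inj₂ p∣k!*[p∸k]! with euclidsLemma (k !) ((suc p-1 ℕ.∸ k) !) p-prime p∣k!*[p∸k]!
...   | inj₁ p∣k! = contradiction p∣k! (prime∤! p-prime k k<p)
...   | inj₂ p∣[p∸k]! = contradiction p∣[p∸k]! (prime∤! p-prime (suc p-1 ℕ.∸ k) (ℕ.∸-monoʳ-< 0<k (ℕ.<⇒≤ k<p)))

-- Sums over initial segments of the natural numbers.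

module RangeSum {a ℓ} (M : CommutativeMonoid a ℓ) where

  open CommutativeMonoid M
    renaming (_∙_ to _+_; ∙-cong to +-cong; ∙-congˡ to +-congˡ; ∙-congʳ to +-congʳ;
              identityˡ to +-identityˡ; identityʳ to +-identityʳ; assoc to +-assoc; comm to +-comm;
              ε to 0#)
  open CMSum M
  open import Relation.Binary.Reasoning.Setoid setoid

  Σ< : ℕ → (ℕ → Carrier) → Carrier
  Σ< n g = sum {n} (g ∘ toℕ)

  Σ<-cong : ∀ n {g h} → (∀ i → g i ≈ h i) → Σ< n g ≈ Σ< n h
  Σ<-cong n g≈h = sum-cong-≋ {n} (g≈h ∘ toℕ)

  Σ<-snoc : ∀ n g → Σ< (suc n) g ≈ Σ< n g + g n
  Σ<-snoc zero    g = +-comm (g 0) 0#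
  Σ<-snoc (suc n) g = trans (+-congˡ (Σ<-snoc n (g ∘ suc))) (sym (+-assoc _ _ _))

  -- Both sides are the sum of g 0, ..., g n, with either the first or the last term split off. This
  -- is telescoping without subtraction: when g 0 and g n agree, or can be compared, cancellation
  -- finishes the argument.
  Σ<-rotate : ∀ n g → Σ< n (g ∘ suc) + g 0 ≈ Σ< n g + g n
  Σ<-rotate n g = trans (+-comm _ _) (Σ<-snoc n g)

  Σ<-+ : ∀ m n g → Σ< (m ℕ.+ n) g ≈ Σ< m g + Σ< n (g ∘ (m ℕ.+_))
  Σ<-+ zero    n g = sym (+-identityˡ _)
  Σ<-+ (suc m) n g = trans (+-congˡ (Σ<-+ m n (g ∘ suc))) (sym (+-assoc _ _ _))

  -- Division with remainder by n groups the indices below m n. The transitivity of the trace rests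
  -- on this regrouping.
  Σ<-* : ∀ m n g → Σ< (m ℕ.* n) g ≈ Σ< m λ j → Σ< n λ i → g (j ℕ.* n ℕ.+ i)
  Σ<-* zero    n g = refl
  Σ<-* (suc m) n g = trans (Σ<-+ n (m ℕ.* n) g) (+-congˡ (trans (Σ<-* m n (g ∘ (n ℕ.+_)))
    (Σ<-cong m λ j → Σ<-cong n λ i → reflexive (cong g (≡.sym (ℕ.+-assoc n (j ℕ.* n) i))))))

  -- A function of period n depends only on the residue modulo n, and multiplication by s permutes
  -- the residues when s and n are coprime.
  Σ<-scale : ∀ s n .{{_ : NonZero n}} → gcd s n ≡ 1 → ∀ g → (∀ k → g (n ℕ.+ k) ≈ g k) →
             Σ< n (λ i → g (s ℕ.* i)) ≈ Σ< n g
  Σ<-scale s n s⊥n g periodic = begin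
    Σ< n (λ i → g (s ℕ.* i))          ≈⟨ Σ<-cong n (λ i → g[k]≈g[k%n] (s ℕ.* i)) ⟩
    Σ< n (λ i → g ((s ℕ.* i) % n))
      ≈⟨ sum-cong-≋ {n} (λ i → reflexive (cong g (≡.sym (Fin.toℕ-fromℕ< (m%n<n (s ℕ.* toℕ i) n))))) ⟩
    sum (g ∘ toℕ ∘ scale s n)
      ≈⟨ sum-permute (g ∘ toℕ) (injective⇒permutation (scale s n) (scale-injective s n s⊥n)) ⟨
    Σ< n g                            ∎
    where
    g[mn+k]≈g[k] : ∀ m k → g (m ℕ.* n ℕ.+ k) ≈ g k
    g[mn+k]≈g[k] zero    k = refl
    g[mn+k]≈g[k] (suc m) k = trans (reflexive (cong g (ℕ.+-assoc n (m ℕ.* n) k)))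
      (trans (periodic (m ℕ.* n ℕ.+ k)) (g[mn+k]≈g[k] m k))
    g[k]≈g[k%n] : ∀ k → g k ≈ g (k % n)
    g[k]≈g[k%n] k = trans
      (reflexive (cong g (≡.trans (m≡m%n+[m/n]*n k n) (ℕ.+-comm (k % n) _)))) (g[mn+k]≈g[k] (k / n) (k % n))

-- Additivity of the Frobenius map in characteristic p.

module Frobenius {a ℓ} (S : CommutativeSemiring a ℓ) where

  open CommutativeSemiring S
  open Exp S
  open Mult semiring renaming (_×_ to _·_)
  open SemiringSum semiring using (sum-cong-≋; sum-replicate-zero)
  open RangeSum +-commutativeMonoid
  open import Relation.Binary.Reasoning.Setoid setoid

  module _ {p : ℕ} (p-prime : Prime p) (p·1≈0 : p · 1# ≈ 0#) where

    p∣m⇒m·x≈0 : ∀ {m} x → p ∣ m → m · x ≈ 0#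
    p∣m⇒m·x≈0 x (divides k ≡.refl) = begin
      (k ℕ.* p) · x             ≈⟨ ×-congʳ (k ℕ.* p) (*-identityˡ x) ⟨
      (k ℕ.* p) · (1# * x)      ≈⟨ ×-assoc-* (k ℕ.* p) 1# x ⟨
      ((k ℕ.* p) · 1#) * x      ≈⟨ *-congʳ (×1-homo-* k p) ⟩
      (k · 1#) * (p · 1#) * x   ≈⟨ *-congʳ (*-congˡ p·1≈0) ⟩
      (k · 1#) * 0# * x         ≈⟨ *-congʳ (zeroʳ _) ⟩
      0# * x                    ≈⟨ zeroˡ x ⟩
      0#                        ∎

    ^p-distrib-+ : ∀ x y → (x + y) ^ p ≈ x ^ p + y ^ p
    ^p-distrib-+ x y = go p ≡.refl
      where
      term : ℕ → ℕ → Carrier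
      term n k = (n C k) · (x ^ k * y ^ (n ∸ k))

      -- The exponent is generalised to an `n` equal to `p`, so that matching exposes a successor
      -- and the two outer binomial terms can be split off; p kills all the terms between them.
      go : ∀ n → n ≡ p → (x + y) ^ n ≈ x ^ n + y ^ n
      go zero n≡p = contradiction n≡p (≡.≢-sym (ℕ.≢-nonZero⁻¹ p {{prime⇒nonZero p-prime}}))
      go n@(suc n-1) ≡.refl = begin
        (x + y) ^ n                                        ≈⟨ Binomial.theorem S n x y ⟩
        term n 0 + Σ< n (term n ∘ suc)                     ≈⟨ +-congˡ (Σ<-snoc n-1 (term n ∘ suc)) ⟩
        term n 0 + (Σ< n-1 (term n ∘ suc) + term n n)      ≈⟨ +-cong first (+-cong middle last) ⟩
        y ^ n + (0# + x ^ n)                               ≈⟨ +-congˡ (+-identityˡ _) ⟩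
        y ^ n + x ^ n                                      ≈⟨ +-comm _ _ ⟩
        x ^ n + y ^ n                                      ∎
        where
        first : term n 0 ≈ y ^ n
        first = trans (+-identityʳ _) (*-identityˡ _)
        middle : Σ< n-1 (term n ∘ suc) ≈ 0#
        middle = trans
          (sum-cong-≋ {n-1} λ i → p∣m⇒m·x≈0 _ (prime∣C p-prime (s≤s z≤n) (s≤s (Fin.toℕ<n i))))
          (sum-replicate-zero n-1)
        last : term n n ≈ x ^ n
        last = begin
          (n C n) · (x ^ n * y ^ (n ∸ n))  ≈⟨ ×-congˡ (nCn≡1 n) ⟩
          1 · (x ^ n * y ^ (n ∸ n))        ≈⟨ ×-homo-1 _ ⟩
          x ^ n * y ^ (n ∸ n)              ≈⟨ *-congˡ (^-congʳ y (ℕ.n∸n≡0 n)) ⟩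
          x ^ n * 1#                       ≈⟨ *-identityʳ _ ⟩
          x ^ n                            ∎

    ^p^k-distrib-+ : ∀ k x y → (x + y) ^ (p ℕ.^ k) ≈ x ^ (p ℕ.^ k) + y ^ (p ℕ.^ k)
    ^p^k-distrib-+ zero    x y = trans (*-identityʳ _) (sym (+-cong (*-identityʳ x) (*-identityʳ y)))
    ^p^k-distrib-+ (suc k) x y = begin
      (x + y) ^ (p ℕ.* p ℕ.^ k)                      ≈⟨ ^-assocʳ (x + y) p (p ℕ.^ k) ⟨
      ((x + y) ^ p) ^ (p ℕ.^ k)                      ≈⟨ ^-congˡ (p ℕ.^ k) (^p-distrib-+ x y) ⟩
      (x ^ p + y ^ p) ^ (p ℕ.^ k)                    ≈⟨ ^p^k-distrib-+ k (x ^ p) (y ^ p) ⟩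
      (x ^ p) ^ (p ℕ.^ k) + (y ^ p) ^ (p ℕ.^ k)
        ≈⟨ +-cong (^-assocʳ x p (p ℕ.^ k)) (^-assocʳ y p (p ℕ.^ k)) ⟩
      x ^ (p ℕ.* p ℕ.^ k) + y ^ (p ℕ.* p ℕ.^ k)      ∎

-- Polynomial functions and the number of their roots.

module Polynomial {a ℓ} (S : CommutativeSemiring a ℓ) where

  open CommutativeSemiring S hiding (zero)
  open Exp S
  open RangeSum +-commutativeMonoid
  open Solver S using (solve; _:+_; _:*_; _:=_)
  open import Relation.Binary.Reasoning.Setoid setoid

  eval : ∀ {d} → Vec Carrier d → Carrier → Carrier
  eval []      x = 0#
  eval (c ∷ v) x = c + x * eval v x

  -- The value at x of x^d plus the polynomial of degree < d with coefficients v.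
  evalMonic : ∀ {d} → Vec Carrier d → Carrier → Carrier
  evalMonic []      x = 1#
  evalMonic (c ∷ v) x = c + x * evalMonic v x

  x^d+eval : ∀ {d} (v : Vec Carrier d) x → x ^ d + eval v x ≈ evalMonic v x
  x^d+eval []      x = +-identityʳ 1#
  x^d+eval {suc d} (c ∷ v) x = trans
    (solve 4 (λ x p c e → x :* p :+ (c :+ x :* e) := c :+ x :* (p :+ e)) refl x (x ^ d) c (eval v x))
    (+-congˡ (*-congˡ (x^d+eval v x)))

  -- Division by x - a, with the terms moved so that no subtraction occurs.
  divide-linear : ∀ {d} (v : Vec Carrier (suc d)) a →
    ∃[ w ] ∀ x → evalMonic v x + a * evalMonic {d} w x ≈ evalMonic v a + x * evalMonic w x
  divide-linear (c ∷ []) a = [] , λ x →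
    solve 4 (λ x c a e → (c :+ x :* e) :+ a :* e := (c :+ a :* e) :+ x :* e) refl x c a 1#
  divide-linear (c ∷ v@(_ ∷ _)) a with divide-linear v a
  -- Synthetic division: the remainder `r` of the tail, its value at `a`, becomes the constant
  -- coefficient of the quotient.
  ... | w , eq = r ∷ w , λ x → let V = evalMonic v x; W = evalMonic w x in begin
    (c + x * V) + a * (r + x * W)
      ≈⟨ solve 6 (λ x c a r V W →
        (c :+ x :* V) :+ a :* (r :+ x :* W) := (c :+ a :* r) :+ x :* (V :+ a :* W)) refl x c a r V W ⟩
    (c + a * r) + x * (V + a * W)   ≈⟨ +-congˡ (*-congˡ (eq x)) ⟩
    (c + a * r) + x * (r + x * W)   ∎
    where r = evalMonic v a

  -- A property of functions: some polynomial with `d` coefficients, constant term first, induces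
  -- `f`.
  Degree<_ : ℕ → (Carrier → Carrier) → Set _
  (Degree< d) f = ∃[ v ] ∀ x → f x ≈ eval {d} v x

  0-degree : ∀ d → (Degree< d) (λ _ → 0#)
  0-degree zero    = [] , λ _ → refl
  0-degree (suc d) = let v , eq = 0-degree d in
    0# ∷ v , λ x → trans (sym (zeroʳ x)) (trans (*-congˡ (eq x)) (sym (+-identityˡ _)))

  ^-degree : ∀ k {d} → k ℕ.< d → (Degree< d) (_^ k)
  ^-degree zero {suc d} _ = let v , eq = 0-degree d in
    1# ∷ v , λ x → trans (sym (+-identityʳ 1#)) (+-congˡ (trans (sym (zeroʳ x)) (*-congˡ (eq x))))
  ^-degree (suc k) {suc d} (s≤s k<d) = let v , eq = ^-degree k k<d in
    0# ∷ v , λ x → trans (*-congˡ (eq x)) (sym (+-identityˡ _))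

  +-degree : ∀ {d f g} → (Degree< d) f → (Degree< d) g → (Degree< d) (λ x → f x + g x)
  +-degree {zero}  ([] , f≈) ([] , g≈) = [] , λ x → trans (+-cong (f≈ x) (g≈ x)) (+-identityʳ 0#)
  +-degree {suc d} (a ∷ u , f≈) (b ∷ v , g≈) =
    let w , eq = +-degree {d} (u , λ _ → refl) (v , λ _ → refl) in
    a + b ∷ w , λ x → begin
      _                                       ≈⟨ +-cong (f≈ x) (g≈ x) ⟩
      (a + x * eval u x) + (b + x * eval v x)
        ≈⟨ solve 5 (λ x a b s t →
          (a :+ x :* s) :+ (b :+ x :* t) := (a :+ b) :+ x :* (s :+ t)) refl x a b (eval u x) (eval v x) ⟩
      (a + b) + x * (eval u x + eval v x)     ≈⟨ +-congˡ (*-congˡ (eq x)) ⟩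
      (a + b) + x * eval w x                  ∎

  Σ<-degree : ∀ m {d} {g : ℕ → Carrier → Carrier} → (∀ i → i ℕ.< m → (Degree< d) (g i)) →
              (Degree< d) (λ x → Σ< m (λ i → g i x))
  Σ<-degree zero    _  = 0-degree _
  Σ<-degree (suc m) g< = +-degree (g< 0 (s≤s z≤n)) (Σ<-degree m λ i i<m → g< (suc i) (s≤s i<m))

module Roots {a ℓ} (S : CommutativeRing a ℓ) where

  open CommutativeRing S hiding (zero)
  open Polynomial commutativeSemiring
  open import Relation.Binary.Reasoning.Setoid setoid

  module _ (1≉0 : ¬ 1# ≈ 0#) (*-cancel : ∀ {x y z} → ¬ x ≈ y → x * z ≈ y * z → z ≈ 0#) where

    -- Induction on the degree. Dividing by x - r 0 leaves a monic quotient of degree one less,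
    -- which vanishes at the remaining points because they differ from r 0. The hypothesis
    -- `*-cancel` expresses the absence of zero divisors in the subtraction-free form that
    -- `divide-linear` produces.
    roots≤degree : ∀ {d} (v : Vec Carrier d) (r : Fin (suc d) → Carrier) →
      (∀ {i j} → r i ≈ r j → i ≡ j) → ¬ (∀ i → evalMonic v (r i) ≈ 0#)
    roots≤degree {zero}  []  r r-inj vanish = 1≉0 (vanish zero)
    roots≤degree {suc d} v r r-inj vanish with divide-linear v (r zero)
    ... | w , eq = roots≤degree w (r ∘ suc) (Fin.suc-injective ∘ r-inj) λ i →
      *-cancel {r zero} {r (suc i)} ((λ ()) ∘ r-inj) (begin
        r zero * evalMonic w (r (suc i))  ≈⟨ +-identityˡ _ ⟨
        0# + r zero * evalMonic w (r (suc i))  ≈⟨ +-congʳ (vanish (suc i)) ⟨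
        evalMonic v (r (suc i)) + r zero * evalMonic w (r (suc i))  ≈⟨ eq (r (suc i)) ⟩
        evalMonic v (r zero) + r (suc i) * evalMonic w (r (suc i))  ≈⟨ +-congʳ (vanish zero) ⟩
        0# + r (suc i) * evalMonic w (r (suc i))  ≈⟨ +-identityˡ _ ⟩
        r (suc i) * evalMonic w (r (suc i))  ∎)

-- Finite fields: decidable equality, inverses, characteristic and x^N = x.

module FiniteField {c ℓ₁ ℓ₂} (F : HeytingField c ℓ₁ ℓ₂) {N : ℕ} (ord : HasOrder F N) (1<N : 1 ℕ.< N) where

  open Maps F hiding (sum; _^_; zero)
  open Exp commutativeSemiring
  open Mult semiring renaming (_×_ to _·_)
  open Group +-group using () renaming
    (∙-cancelˡ to +-cancelˡ; ∙-cancelʳ to +-cancelʳ;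
     x∙y⁻¹≈ε⇒x≈y to x-y≈0⇒x≈y; x≈y⇒x∙y⁻¹≈ε to x≈y⇒x-y≈0) public
  open Ring ring using ([y-z]x≈yx-zx)
  open import Relation.Binary.Reasoning.Setoid setoid
  module + = CMSum +-commutativeMonoid
  module * = CMSum *-commutativeMonoid

  index : Carrier → Fin N
  index = Inverse.to ord

  element : Fin N → Carrier
  element = Inverse.from ord

  element-index : ∀ x → element (index x) ≈ x
  element-index x = Inverse.strictlyInverseʳ ord x

  index-injective : ∀ {x y} → index x ≡ index y → x ≈ y
  index-injective {x} {y} eq =
    trans (sym (element-index x)) (trans (reflexive (cong element eq)) (element-index y))

  element-injective : ∀ {i j} → element i ≈ element j → i ≡ j
  element-injective {i} {j} eq = ≡.trans (≡.sym (Inverse.strictlyInverseˡ ord i))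
    (≡.trans (Inverse.to-cong ord eq) (Inverse.strictlyInverseˡ ord j))

  infix 4 _≈?_

  _≈?_ : ∀ x y → Dec (x ≈ y)
  x ≈? y = map′ index-injective (Inverse.to-cong ord) (index x Fin.≟ index y)

  -- If 1 = 0, all elements coincide, so `Fin N` would inject into a one-element set, against 1 < N.
  1≉0 : ¬ 1# ≈ 0#
  1≉0 1≈0 = ℕ.<⇒≱ 1<N (Fin.injective⇒≤ {f = λ _ → zero {0}} λ {i} {j} _ →
    element-injective (trans (x≈0 (element i)) (sym (x≈0 (element j)))))
    where
    x≈0 : ∀ x → x ≈ 0#
    x≈0 x = trans (sym (*-identityˡ x)) (trans (*-congʳ 1≈0) (zeroˡ x))

  -- By tightness it is enough to refute that y is apart from 0. Apartness would make y - 0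
  -- invertible, and multiplying x y = 0 by the inverse would give x = 0.
  xy≈0⇒y≈0 : ∀ {x y} → ¬ x ≈ 0# → x * y ≈ 0# → y ≈ 0#
  xy≈0⇒y≈0 {x} {y} x≉0 xy≈0 = proj₁ (HeytingField.tight F y 0#) λ y#0 →
    let z , _ , [y-0]z≈1 = HeytingField.#⇒invertible F y#0 in
    x≉0 (begin
      x                    ≈⟨ *-identityʳ x ⟨
      x * 1#               ≈⟨ *-congˡ [y-0]z≈1 ⟨
      x * ((y - 0#) * z)   ≈⟨ *-assoc x _ z ⟨
      x * (y - 0#) * z     ≈⟨ *-congʳ (*-congˡ (trans (+-congˡ -0≈0) (+-identityʳ y))) ⟩
      x * y * z            ≈⟨ *-congʳ xy≈0 ⟩
      0# * z               ≈⟨ zeroˡ z ⟩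
      0#                   ∎)
    where -0≈0 = Group.ε⁻¹≈ε +-group

  *-cancelʳ-≉ : ∀ {x y z} → ¬ x ≈ y → x * z ≈ y * z → z ≈ 0#
  *-cancelʳ-≉ {x} {y} {z} x≉y xz≈yz = xy≈0⇒y≈0 (x≉y ∘ x-y≈0⇒x≈y x y)
    (trans ([y-z]x≈yx-zx z x y) (x≈y⇒x-y≈0 xz≈yz))

  *-cancelˡ : ∀ {x y z} → ¬ x ≈ 0# → x * y ≈ x * z → y ≈ z
  *-cancelˡ {x} {y} {z} x≉0 xy≈xz = x-y≈0⇒x≈y y z (xy≈0⇒y≈0 x≉0
    (trans (Ring.x[y-z]≈xy-xz ring x y z) (x≈y⇒x-y≈0 xy≈xz)))

  ≉0-* : ∀ {x y} → ¬ x ≈ 0# → ¬ y ≈ 0# → ¬ x * y ≈ 0#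
  ≉0-* x≉0 y≉0 = y≉0 ∘ xy≈0⇒y≈0 x≉0

  module _ (φ : Carrier → Carrier) (φ-injective : Injective _≈_ _≈_ φ) where

    private
      step : Fin N → Fin N
      step i = index (φ (element i))

      step-injective : Injective _≡_ _≡_ step
      step-injective = element-injective ∘ φ-injective ∘ index-injective

    surjective : ∀ y → ∃[ x ] φ x ≈ y
    surjective y = let i , eq = injective⇒surjective step-injective (index y) in
      element i , index-injective eq

    reindexing : Permutation′ N
    reindexing = injective⇒permutation step step-injective

    element-reindexing : ∀ i → element (reindexing ⟨$⟩ʳ i) ≈ φ (element i)
    element-reindexing i = element-index _

  -- Multiplication by a nonzero x is injective, hence surjective on a finite set, so it takes the
  -- value 1.
  inverse : ∀ {x} → ¬ x ≈ 0# → ∃[ y ] x * y ≈ 1#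
  inverse {x} x≉0 = surjective (x *_) (*-cancelˡ x≉0) 1#

  -- Translation by 1 permutes the elements, hence preserves their sum.
  N·1≈0 : N · 1# ≈ 0#
  N·1≈0 = +-cancelʳ S _ _ (begin
    N · 1# + S                              ≈⟨ +-congʳ (+.sum-replicate N) ⟨
    +.sum {N} (λ _ → 1#) + S                ≈⟨ +.∑-distrib-+ (λ _ → 1#) element ⟨
    +.sum (λ i → 1# + element i)
      ≈⟨ +.sum-cong-≋ (element-reindexing (1# +_) (+-cancelˡ 1# _ _)) ⟨
    +.sum (λ i → element (π ⟨$⟩ʳ i))        ≈⟨ +.sum-permute element π ⟨
    S                                       ≈⟨ +-identityˡ S ⟨
    0# + S                                  ∎)
    where
    S = +.sum element
    π = reindexing (1# +_) (+-cancelˡ 1# _ _)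

  -- The element (p^k) · 1 is the k-th power of p · 1, and there are no zero divisors.
  p^k·1≈0⇒p·1≈0 : ∀ p k → (p ℕ.^ k) · 1# ≈ 0# → p · 1# ≈ 0#
  p^k·1≈0⇒p·1≈0 p zero    1·1≈0 = contradiction (trans (sym (×-homo-1 1#)) 1·1≈0) 1≉0
  p^k·1≈0⇒p·1≈0 p (suc k) eq with p · 1# ≈? 0#
  ... | yes p·1≈0 = p·1≈0
  ... | no  p·1≉0 = p^k·1≈0⇒p·1≈0 p k (xy≈0⇒y≈0 p·1≉0 (trans (sym (×1-homo-* p (p ℕ.^ k))) eq))

  ∏≉0 : ∀ {n} (a : Fin n → Carrier) → (∀ i → ¬ a i ≈ 0#) → ¬ *.sum a ≈ 0#
  ∏≉0 {zero}  a a≉0 = 1≉0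
  ∏≉0 {suc n} a a≉0 = ≉0-* (a≉0 zero) (∏≉0 (a ∘ suc) (a≉0 ∘ suc))

  -- The exceptional index will be that of the zero element. The extra factor x makes up for it, so
  -- the exponent is the full order of the field.
  ∏-but-one : ∀ {n} (a : Fin n → Carrier) x k → a k ≈ 1# → (∀ i → i ≢ k → a i ≈ x) → x * *.sum a ≈ x ^ n
  ∏-but-one {suc n} a x k a[k]≈1 a≈x = *-congˡ (begin
    *.sum a                       ≈⟨ *.sum-remove {i = k} a ⟩
    a k * *.sum (removeAt a k)    ≈⟨ *-congʳ a[k]≈1 ⟩
    1# * *.sum (removeAt a k)     ≈⟨ *-identityˡ _ ⟩
    *.sum (removeAt a k)          ≈⟨ *.sum-cong-≋ (λ i → a≈x _ (Fin.punchInᵢ≢i k i)) ⟩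
    *.sum {n} (λ _ → x)           ≈⟨ *.sum-replicate n ⟩
    x ^ n                         ∎)

  -- Multiplication by x ≉ 0 permutes the elements, hence preserves the product of the nonzero ones.
  x^N≈x : ∀ x → x ^ N ≈ x
  x^N≈x x with x ≈? 0#
  ... | yes x≈0 = trans (^-congˡ N x≈0) (trans (0^N 1<N) (sym x≈0))
    where
    0^N : ∀ {k} → 1 ℕ.< k → 0# ^ k ≈ 0#
    0^N (s≤s _) = zeroˡ _
  ... | no x≉0 = begin
    x ^ N
      ≈⟨ ∏-but-one h x (index 0#) (unless0-≈0 (element-index 0#)) (λ i i≢ → unless0-≉0 (i≢ ∘ zero-index)) ⟨
    x * *.sum h      ≈⟨ *-congˡ ∏h≈1 ⟩
    x * 1#           ≈⟨ *-identityʳ x ⟩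
    x                ∎
    where
    zero-index : ∀ {i} → element i ≈ 0# → i ≡ index 0#
    zero-index e≈0 = element-injective (trans e≈0 (sym (element-index 0#)))

    -- Putting 1 in the place of the zero element lets products over all N indices stand for
    -- products over the nonzero elements.
    unless0 : Carrier → Carrier → Carrier
    unless0 a u = if does (a ≈? 0#) then 1# else u

    unless0-≈0 : ∀ {a u} → a ≈ 0# → unless0 a u ≈ 1#
    unless0-≈0 {a} {u} a≈0 = reflexive (cong (if_then 1# else u) (dec-true (a ≈? 0#) a≈0))

    unless0-≉0 : ∀ {a u} → ¬ a ≈ 0# → unless0 a u ≈ u
    unless0-≉0 {a} {u} a≉0 = reflexive (cong (if_then 1# else u) (dec-false (a ≈? 0#) a≉0))

    nonzero : Carrier → Carrier
    nonzero a = unless0 a a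

    nonzero≉0 : ∀ a → ¬ nonzero a ≈ 0#
    nonzero≉0 a = go (a ≈? 0#)
      where
      go : Dec (a ≈ 0#) → ¬ nonzero a ≈ 0#
      go (yes a≈0) = 1≉0 ∘ trans (sym (unless0-≈0 a≈0))
      go (no a≉0)  = a≉0 ∘ trans (sym (unless0-≉0 a≉0))

    h : Fin N → Carrier
    h i = unless0 (element i) x

    π = reindexing (x *_) (*-cancelˡ x≉0)

    nonzero-π : ∀ i → nonzero (element (π ⟨$⟩ʳ i)) ≈ h i * nonzero (element i)
    nonzero-π i = go (element i ≈? 0#)
      where
      go : Dec (element i ≈ 0#) → nonzero (element (π ⟨$⟩ʳ i)) ≈ h i * nonzero (element i)
      go (yes e≈0) = begin
        nonzero (element (π ⟨$⟩ʳ i))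
          ≈⟨ unless0-≈0 (trans (element-reindexing _ (*-cancelˡ x≉0) i) (trans (*-congˡ e≈0) (zeroʳ x))) ⟩
        1#                            ≈⟨ *-identityʳ 1# ⟨
        1# * 1#                       ≈⟨ *-cong (unless0-≈0 e≈0) (unless0-≈0 e≈0) ⟨
        h i * nonzero (element i)     ∎
      go (no e≉0) = begin
        nonzero (element (π ⟨$⟩ʳ i))
          ≈⟨ unless0-≉0 (≉0-* x≉0 e≉0 ∘ trans (sym (element-reindexing _ (*-cancelˡ x≉0) i))) ⟩
        element (π ⟨$⟩ʳ i)             ≈⟨ element-reindexing _ (*-cancelˡ x≉0) i ⟩
        x * element i                 ≈⟨ *-cong (unless0-≉0 e≉0) (unless0-≉0 e≉0) ⟨
        h i * nonzero (element i)     ∎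

    P = *.sum (nonzero ∘ element)

    ∏h≈1 : *.sum h ≈ 1#
    ∏h≈1 = *-cancelˡ (∏≉0 _ (nonzero≉0 ∘ element)) (begin
      P * *.sum h                                   ≈⟨ *-comm P _ ⟩
      *.sum h * P                                   ≈⟨ *.∑-distrib-+ h (nonzero ∘ element) ⟨
      *.sum (λ i → h i * nonzero (element i))       ≈⟨ *.sum-cong-≋ nonzero-π ⟨
      *.sum (λ i → nonzero (element (π ⟨$⟩ʳ i)))    ≈⟨ *.sum-permute (nonzero ∘ element) π ⟨
      P                                             ≈⟨ *-identityʳ P ⟨
      P * 1#                                        ∎)

-- Additive maps, powers of the q-Frobenius and an element of trace one.

module AdditiveMap {a ℓ} (R : CommutativeRing a ℓ) where

  open CommutativeRing R hiding (zero)
  open SemiringSum semiring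

  module _ (φ : Carrier → Carrier) (φ-cong : φ Preserves _≈_ ⟶ _≈_)
    (φ-+ : ∀ x y → φ (x + y) ≈ φ x + φ y) where

    φ-0 : φ 0# ≈ 0#
    φ-0 = Ring.x+x≈x⇒x≈0 ring (φ 0#) (trans (sym (φ-+ 0# 0#)) (φ-cong (+-identityʳ 0#)))

    φ-sum : ∀ {m} (a : Fin m → Carrier) → φ (sum a) ≈ sum (φ ∘ a)
    φ-sum {zero}  a = φ-0
    φ-sum {suc m} a = trans (φ-+ _ _) (+-congˡ (φ-sum (a ∘ Fin.suc)))

primePower>1 : ∀ {q} → IsPrimePower q → 1 ℕ.< q
primePower>1 (p , k , p-prime , k≢0 , ≡.refl) =
  ℕ.^-monoʳ-< p (ℕ.nonTrivial⇒n>1 p {{prime⇒nonTrivial p-prime}}) (ℕ.>-nonZero⁻¹ k {{k≢0}})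

module _ {c ℓ₁ ℓ₂} (F : HeytingField c ℓ₁ ℓ₂) {q : ℕ} (q-primePower : IsPrimePower q)
  (n t : ℕ) .{{n≢0 : NonZero n}} .{{t≢0 : NonZero t}} (ord : HasOrder F (q ℕ.^ (n ℕ.* t))) where

  private
    1<q : 1 ℕ.< q
    1<q = primePower>1 q-primePower

    instance
      nt≢0 : NonZero (n ℕ.* t)
      nt≢0 = ℕ.m*n≢0 n t

  open Maps F using (Carrier; _≈_; 0#; 1#; _+_; _*_; commutativeSemiring; +-commutativeMonoid;
    setoid; semiring; refl; sym; trans; reflexive; +-cong; +-congˡ; +-congʳ; *-cong; *-congˡ; *-congʳ;
    *-identityˡ; *-identityʳ; *-assoc; *-comm; -_; +-comm; -‿inverseˡ; ker; E₁; image; _^∘_)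
  open Exp commutativeSemiring
  open SemiringSum semiring
  open Mult semiring using (×-congˡ)
  open RangeSum +-commutativeMonoid
  open FiniteField F ord (ℕ.^-monoʳ-< q 1<q (ℕ.>-nonZero⁻¹ (n ℕ.* t)))
  open import Relation.Binary.Reasoning.Setoid setoid

  frob : ℕ → Carrier → Carrier
  frob k x = x ^ (q ℕ.^ k)

  frob-cong : ∀ k → frob k Preserves _≈_ ⟶ _≈_
  frob-cong k = ^-congˡ (q ℕ.^ k)

  frob-index : ∀ {j k} x → j ≡ k → frob j x ≈ frob k x
  frob-index x j≡k = reflexive (cong (λ i → frob i x) j≡k)

  frob-* : ∀ k x y → frob k (x * y) ≈ frob k x * frob k y
  frob-* k x y = ^-distrib-* x y (q ℕ.^ k)

  frob-+ : ∀ k x y → frob k (x + y) ≈ frob k x + frob k y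
  frob-+ k x y = let p , e , p-prime , _ , q≡p^e = q-primePower in
    let q^m≡p^em = λ m → ≡.trans (cong (ℕ._^ m) q≡p^e) (ℕ.^-*-assoc p e m) in
    -- The order of the field is the power p^(e n t), so the vanishing of N · 1 forces
    -- characteristic p.
    let p·1≈0 = p^k·1≈0⇒p·1≈0 p (e ℕ.* (n ℕ.* t))
                  (trans (×-congˡ (≡.sym (q^m≡p^em (n ℕ.* t)))) N·1≈0) in begin
      (x + y) ^ (q ℕ.^ k)                              ≈⟨ ^-congʳ (x + y) (q^m≡p^em k) ⟩
      (x + y) ^ (p ℕ.^ (e ℕ.* k))
        ≈⟨ Frobenius.^p^k-distrib-+ commutativeSemiring p-prime p·1≈0 (e ℕ.* k) x y ⟩
      x ^ (p ℕ.^ (e ℕ.* k)) + y ^ (p ℕ.^ (e ℕ.* k))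
        ≈⟨ +-cong (^-congʳ x (q^m≡p^em k)) (^-congʳ y (q^m≡p^em k)) ⟨
      x ^ (q ℕ.^ k) + y ^ (q ℕ.^ k)                    ∎

  frob-sum : ∀ k {m} (a : Fin m → Carrier) → frob k (sum a) ≈ sum (frob k ∘ a)
  frob-sum k = AdditiveMap.φ-sum (commutativeRing F) (frob k) (frob-cong k) (frob-+ k)

  frob-∘ : ∀ j k x → frob j (frob k x) ≈ frob (j ℕ.+ k) x
  frob-∘ j k x = trans (^-assocʳ x (q ℕ.^ k) (q ℕ.^ j))
    (^-congʳ x (≡.trans (≡.sym (ℕ.^-distribˡ-+-* q k j)) (cong (q ℕ.^_) (ℕ.+-comm k j))))

  frob-swap : ∀ j k x → frob j (frob k x) ≈ frob k (frob j x)
  frob-swap j k x = trans (frob-∘ j k x)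
    (trans (frob-index x (ℕ.+-comm j k)) (sym (frob-∘ k j x)))

  frob-0 : ∀ x → frob 0 x ≈ x
  frob-0 = *-identityʳ

  frob-1# : ∀ k → frob k 1# ≈ 1#
  frob-1# k = 1^m (q ℕ.^ k)
    where
    1^m : ∀ m → 1# ^ m ≈ 1#
    1^m zero    = refl
    1^m (suc m) = trans (*-identityˡ _) (1^m m)

  frob-fixed-* : ∀ m k {x} → frob m x ≈ x → frob (m ℕ.* k) x ≈ x
  frob-fixed-* m zero    {x} fixed rewrite ℕ.*-zeroʳ m = frob-0 x
  frob-fixed-* m (suc k) {x} fixed rewrite ℕ.*-suc m k =
    trans (sym (frob-∘ m (m ℕ.* k) x)) (trans (frob-cong m (frob-fixed-* m k fixed)) fixed)

  -- Applying `frob m` shifts the orbit by one place and its last term returns to `x`, so the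
  -- summands are permuted cyclically. The cases of interest are m = 1, k = nt for the full trace
  -- and m = n, k = t for the trace down to F_{q^n}.
  frob-orbit-sum-fixed : ∀ m k x → frob (k ℕ.* m) x ≈ x →
    frob m (Σ< k (λ j → frob (j ℕ.* m) x)) ≈ Σ< k (λ j → frob (j ℕ.* m) x)
  frob-orbit-sum-fixed m k x closed = begin
    frob m (Σ< k g)                           ≈⟨ frob-sum m {k} _ ⟩
    Σ< k (frob m ∘ g)                         ≈⟨ Σ<-cong k (λ j → frob-∘ m (j ℕ.* m) x) ⟩
    Σ< k (g ∘ suc)
      ≈⟨ +-cancelʳ (g 0) _ _ (trans (Σ<-rotate k g) (+-congˡ (trans closed (sym (frob-0 x))))) ⟩
    Σ< k g                                    ∎
    where
    g : ℕ → Carrier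
    g j = frob (j ℕ.* m) x

  -- The trace of F_{q^{nt}} over F_q.
  trace : Carrier → Carrier
  trace x = Σ< (n ℕ.* t) (λ k → frob k x)

  -- Equality is decidable and the field is finite, so refuting that the trace vanishes everywhere
  -- already yields a witness.
  trace-≉0 : ∃[ z ] ¬ trace z ≈ 0#
  trace-≉0 = let i , ≉0 = Fin.¬∀⟶∃¬ _ _ (λ i → trace (element i) ≈? 0#) (not-all (n ℕ.* t) ≡.refl)
             in element i , ≉0
    where
    open Polynomial commutativeSemiring
    -- Writing nt as `suc m` isolates the leading term x^(q^m). The other terms have degree below
    -- q^m, so the trace is monic of degree q^m.
    not-all : ∀ M → M ≡ n ℕ.* t → ¬ (∀ i → trace (element i) ≈ 0#)
    not-all zero M≡nt _ = ℕ.≢-nonZero⁻¹ (n ℕ.* t) (≡.sym M≡nt)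
    not-all (suc m) M≡nt all≈0 = Roots.roots≤degree (commutativeRing F) 1≉0 *-cancelʳ-≉ v root
      (λ eq → Fin.inject≤-injective q^m<N q^m<N _ _ (element-injective eq))
      λ i → let x = root i in begin
        evalMonic v x                                  ≈⟨ x^d+eval v x ⟨
        frob m x + eval v x                            ≈⟨ +-congˡ (low≈ x) ⟨
        frob m x + Σ< m (λ k → frob k x)               ≈⟨ +-comm _ _ ⟩
        Σ< m (λ k → frob k x) + frob m x               ≈⟨ Σ<-snoc m (λ k → frob k x) ⟨
        Σ< (suc m) (λ k → frob k x)
          ≈⟨ reflexive (cong (λ M → Σ< M (λ k → frob k x)) M≡nt) ⟩
        trace x                                        ≈⟨ all≈0 _ ⟩
        0#                                             ∎
      where
      low = Σ<-degree m {q ℕ.^ m} {frob} (λ k k<m → ^-degree (q ℕ.^ k) (ℕ.^-monoʳ-< q 1<q k<m))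
      v = proj₁ low
      low≈ = proj₂ low
      q^m<N : q ℕ.^ m ℕ.< q ℕ.^ (n ℕ.* t)
      q^m<N = ℕ.^-monoʳ-< q 1<q (≡.subst (m ℕ.<_) M≡nt (ℕ.n<1+n m))
      -- Since q^m < N, there are q^m + 1 distinct field elements available, one more than the
      -- degree allows as roots.
      root = λ i → element (Fin.inject≤ i q^m<N)

  -- Here `μ` is the trace of `z` down to F_{q^n}, and by transitivity its trace over F_q is
  -- `trace z`. The factor `u` inverts that value; it lies in F_q, so it passes through every
  -- Frobenius power.
  trace-one : ∃[ y ] (frob n y ≈ y × Σ< n (λ i → frob i y) ≈ 1#)
  trace-one = μ * u , fixed , (begin
    Σ< n (λ i → frob i (μ * u))
      ≈⟨ Σ<-cong n (λ i → trans (frob-* i μ u) (*-congˡ (frob-u i))) ⟩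
    Σ< n (λ i → frob i μ * u)                              ≈⟨ *-distribʳ-sum {n} u _ ⟨
    Σ< n (λ i → frob i μ) * u                              ≈⟨ *-congʳ subtrace-μ ⟩
    trace z * u                                            ≈⟨ proj₂ (inverse T≉0) ⟩
    1#                                                     ∎)
    where
    z = proj₁ trace-≉0
    T≉0 = proj₂ trace-≉0
    u = proj₁ (inverse T≉0)

    μ : Carrier
    μ = Σ< t (λ j → frob (j ℕ.* n) z)

    frob-T : frob 1 (trace z) ≈ trace z
    frob-T = begin
      frob 1 (trace z)    ≈⟨ frob-cong 1 eq ⟩
      _
        ≈⟨ frob-orbit-sum-fixed 1 (n ℕ.* t) z (trans (frob-index z (ℕ.*-identityʳ (n ℕ.* t))) (x^N≈x z)) ⟩
      _                   ≈⟨ eq ⟨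
      trace z             ∎
      where
      eq : trace z ≈ Σ< (n ℕ.* t) (λ j → frob (j ℕ.* 1) z)
      eq = Σ<-cong (n ℕ.* t) λ j → frob-index z (≡.sym (ℕ.*-identityʳ j))

    -- The image of `u` under Frobenius is again an inverse of the fixed element `trace z`, and
    -- inverses are unique.
    frob-1-u : frob 1 u ≈ u
    frob-1-u = *-cancelˡ T≉0 (begin
      trace z * frob 1 u            ≈⟨ *-congʳ frob-T ⟨
      frob 1 (trace z) * frob 1 u   ≈⟨ frob-* 1 (trace z) u ⟨
      frob 1 (trace z * u)          ≈⟨ frob-cong 1 (proj₂ (inverse T≉0)) ⟩
      frob 1 1#                     ≈⟨ frob-1# 1 ⟩
      1#                            ≈⟨ proj₂ (inverse T≉0) ⟨
      trace z * u                   ∎)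

    frob-u : ∀ k → frob k u ≈ u
    frob-u k = trans (frob-index u (≡.sym (ℕ.*-identityˡ k))) (frob-fixed-* 1 k frob-1-u)

    fixed : frob n (μ * u) ≈ μ * u
    fixed = trans (frob-* n μ u) (*-cong
      (frob-orbit-sum-fixed n t z (trans (frob-index z (ℕ.*-comm t n)) (x^N≈x z)))
      (frob-u n))

    subtrace-μ : Σ< n (λ i → frob i μ) ≈ trace z
    subtrace-μ = begin
      Σ< n (λ i → frob i μ)                                  ≈⟨ Σ<-cong n (λ i → frob-sum i {t} _) ⟩
      Σ< n (λ i → Σ< t (λ j → frob i (frob (j ℕ.* n) z)))    ≈⟨ ∑-comm {n} {t} _ ⟩
      Σ< t (λ j → Σ< n (λ i → frob i (frob (j ℕ.* n) z)))
        -- The exponents j n + i with j < t and i < n run through all k < t n exactly once.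
        ≈⟨ Σ<-cong t (λ j → Σ<-cong n (λ i → trans (frob-swap i (j ℕ.* n) z) (frob-∘ (j ℕ.* n) i z))) ⟩
      Σ< t (λ j → Σ< n (λ i → frob (j ℕ.* n ℕ.+ i) z))       ≈⟨ Σ<-* t n (λ k → frob k z) ⟨
      Σ< (t ℕ.* n) (λ k → frob k z)
        ≈⟨ reflexive (cong (λ m → Σ< m (λ k → frob k z)) (ℕ.*-comm t n)) ⟩
      trace z                                                ∎

  -- Fixed points of H, the kernel of f and the image of L.

  module _ (s : ℕ) (s⊥n : gcd s n ≡ 1) (b : Fin t → Carrier) where

    open Maps.Polynomials F q n t s b

    H-cong : H Preserves _≈_ ⟶ _≈_
    H-cong x≈y = sum-cong-≋ λ i → *-congˡ {b i} (frob-cong (n ℕ.* toℕ i) (frob-cong s x≈y))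

    H-+ : ∀ x y → H (x + y) ≈ H x + H y
    H-+ x y = trans (sum-cong-≋ λ i → begin
        b i * frob (n ℕ.* toℕ i) (frob s (x + y))
          ≈⟨ *-congˡ (trans (frob-cong (n ℕ.* toℕ i) (frob-+ s x y)) (frob-+ (n ℕ.* toℕ i) _ _)) ⟩
        b i * (frob (n ℕ.* toℕ i) (frob s x) + frob (n ℕ.* toℕ i) (frob s y))
          ≈⟨ Maps.distribˡ F (b i) _ _ ⟩
        _                                                         ∎)
      (∑-distrib-+ {t} _ _)

    f≈-x+Hx : ∀ x → f x ≈ - x + H x
    f≈-x+Hx x = +-congˡ (sum-cong-≋ λ i → *-congˡ {b i}
      (sym (trans (frob-swap (n ℕ.* toℕ i) s x) (frob-∘ s (n ℕ.* toℕ i) x))))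

    ker⇒H-fixed : ∀ {x} → f x ≈ 0# → H x ≈ x
    ker⇒H-fixed {x} fx≈0 = +-cancelˡ (- x) _ _
      (trans (sym (f≈-x+Hx x)) (trans fx≈0 (sym (-‿inverseˡ x))))

    H-fixed⇒ker : ∀ {x} → H x ≈ x → f x ≈ 0#
    H-fixed⇒ker {x} Hx≈x = trans (f≈-x+Hx x) (trans (+-congˡ Hx≈x) (-‿inverseˡ x))

    -- An m in F_{q^n} is fixed by every power q^{ni}, so each summand of H moves m by σ alone and
    -- the common factor can be pulled out.
    H-semilinear : ∀ {m} → frob n m ≈ m → ∀ x → H (m * x) ≈ frob s m * H x
    H-semilinear {m} m-fixed x = trans (sum-cong-≋ λ i → let k = n ℕ.* toℕ i in begin
        b i * frob k (frob s (m * x))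
          ≈⟨ *-congˡ (trans (frob-cong k (frob-* s m x)) (frob-* k _ _)) ⟩
        b i * (frob k (frob s m) * frob k (frob s x))
          ≈⟨ *-congˡ (*-congʳ (trans (frob-swap k s m) (frob-cong s (frob-fixed-* n (toℕ i) m-fixed)))) ⟩
        b i * (frob s m * frob k (frob s x))         ≈⟨ *-assoc _ _ _ ⟨
        b i * frob s m * frob k (frob s x)           ≈⟨ *-congʳ (*-comm _ _) ⟩
        frob s m * b i * frob k (frob s x)           ≈⟨ *-assoc _ _ _ ⟩
        frob s m * (b i * frob k (frob s x))         ∎)
      (sym (*-distribˡ-sum {t} (frob s m) _))

    H^-semilinear : ∀ {m x} → frob n m ≈ m → H x ≈ x → ∀ i → (H ^∘ i) (m * x) ≈ frob (s ℕ.* i) m * x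
    H^-semilinear {m} {x} m-fixed Hx≈x zero rewrite ℕ.*-zeroʳ s = *-congʳ (sym (frob-0 m))
    H^-semilinear {m} {x} m-fixed Hx≈x (suc i) rewrite ℕ.*-suc s i = begin
      H ((H ^∘ i) (m * x))                   ≈⟨ H-cong (H^-semilinear m-fixed Hx≈x i) ⟩
      H (frob (s ℕ.* i) m * x)
        -- Frobenius powers commute, so the coefficient reached so far still lies in F_{q^n}.
        ≈⟨ H-semilinear (trans (frob-swap n (s ℕ.* i) m) (frob-cong (s ℕ.* i) m-fixed)) x ⟩
      frob s (frob (s ℕ.* i) m) * H x        ≈⟨ *-cong (frob-∘ s (s ℕ.* i) m) Hx≈x ⟩
      frob (s ℕ.+ s ℕ.* i) m * x             ∎

    ker⊆image : ∀ {x} → ker f x → image L (E₁ (H ^∘ n)) x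
    ker⊆image {x} x∈ker = m * x , H^n-fixed , (begin
      L (m * x)                                ≈⟨ Σ<-cong n (H^-semilinear m-fixed Hx≈x) ⟩
      Σ< n (λ i → frob (s ℕ.* i) m * x)        ≈⟨ *-distribʳ-sum {n} x _ ⟨
      Σ< n (λ i → frob (s ℕ.* i) m) * x        ≈⟨ *-congʳ (Σ<-scale s n s⊥n (λ k → frob k m) periodic) ⟩
      Σ< n (λ i → frob i m) * x                ≈⟨ *-congʳ (proj₂ (proj₂ trace-one)) ⟩
      1# * x                                   ≈⟨ *-identityˡ x ⟩
      x                                        ∎)
      where
      m = proj₁ trace-one
      m-fixed = proj₁ (proj₂ trace-one)
      Hx≈x = ker⇒H-fixed x∈ker
      H^n-fixed : (H ^∘ n) (m * x) ≈ m * x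
      -- After n steps the coefficient is m^{q^{sn}}, which is m because m lies in F_{q^n}.
      H^n-fixed = trans (H^-semilinear m-fixed Hx≈x n)
        (*-congʳ (trans (frob-index m (ℕ.*-comm s n)) (frob-fixed-* n s m-fixed)))
      periodic : ∀ k → frob (n ℕ.+ k) m ≈ frob k m
      periodic k = trans (sym (frob-∘ n k m)) (trans (frob-swap n k m) (frob-cong k m-fixed))

    image⊆ker : ∀ {x} → image L (E₁ (H ^∘ n)) x → ker f x
    image⊆ker {x} (y , H^ny≈y , Ly≈x) = H-fixed⇒ker (begin
      H x                                    ≈⟨ H-cong Ly≈x ⟨
      H (L y)                                ≈⟨ AdditiveMap.φ-sum (commutativeRing F) H H-cong H-+ {n} _ ⟩
      Σ< n (λ i → (H ^∘ suc i) y)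
        -- Adding y = H^0(y) to the shifted sum gives L(y) + H^n(y), which is L(y) + y; the y then
        -- cancels.
        ≈⟨ +-cancelʳ y _ _ (trans (Σ<-rotate n (λ i → (H ^∘ i) y)) (+-congˡ H^ny≈y)) ⟩
      L y                                    ≈⟨ Ly≈x ⟩
      x                                      ∎)

theorem3p1 : ∀ {c ℓ₁ ℓ₂ : Level} (q n t s : ℕ)
    → IsPrimePower q
    → .{{_ : NonZero n}} .{{_ : NonZero t}} .{{_ : NonZero s}}
    → gcd s n ≡ 1
    → (F : HeytingField c ℓ₁ ℓ₂)
    → HasOrder F (q ℕ.^ (n ℕ.* t))
    → let open Maps F in
    (b : Fin t → Carrier)
    → let open Polynomials q n t s b in
    ker f ≐ image L (E₁ (H ^∘ n))
theorem3p1 q n t s q-primePower s⊥n F ord b =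
  ker⊆image F q-primePower n t ord s s⊥n b , image⊆ker F q-primePower n t ord s s⊥n b
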